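{- Let $k\ge 3$ be an integer. Let $(k_r(\lambda))_{r\ge 0}$ be the sequence of polynomials in $\lambda$ defined by $k_0(\lambda)=1$ and, for $r\ge 1$, $$k_{r}(\lambda) = \left(\binom{k-2}{k-3}-\lambda\right)k_{r-1}(\lambda) - \sum_{i=2}^{r}(-1)^{i}\binom{k+i-3}{k-3}k_{r-i}(\lambda).$$ Then for all $r\ge 0$, $$k_{r}(\lambda) = \sum_{\ell=0}^{r}(-1)^\ell\binom{(k-2)(\ell+1)}{r-\ell} \lambda^{\ell}.$$
   Context: Empty sums are $0$; $\binom{a}{b}=0$ for integers $0\le a<b$. -}

module Defs where

open import Data.Nat.Base as ℕ using (ℕ; zero; suc; _∸_)
open import Data.Integer.Base as ℤ using (ℤ; 0ℤ; 1ℤ)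
open import Data.List.Base using (List; []; _∷_; map; foldr; applyUpTo)
open import Relation.Binary.PropositionalEquality using (_≡_)

infix  4 _≈ₚ_
infixl 6 _+ₚ_ _-ₚ_
infixl 7 _*ₚ_
infixr 8 _^ₚ_
infix  5 sumₚ

-- ℤ[X], with a₀ ∷ a₁ ∷ … ∷ aₙ ∷ [] standing for a₀ + a₁X + … + aₙXⁿ.
-- Trailing zeros are allowed, so equality of polynomials is _≈ₚ_ rather than _≡_.
Poly : Set
Poly = List ℤ

coeff : Poly → ℕ → ℤ
coeff []      _       = 0ℤ
coeff (a ∷ p) zero    = a
coeff (a ∷ p) (suc n) = coeff p n

_≈ₚ_ : Poly → Poly → Set
p ≈ₚ q = ∀ n → coeff p n ≡ coeff q n

const : ℤ → Poly
const a = a ∷ []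

X : Poly
X = 0ℤ ∷ 1ℤ ∷ []

_+ₚ_ : Poly → Poly → Poly
[]      +ₚ q       = q
(a ∷ p) +ₚ []      = a ∷ p
(a ∷ p) +ₚ (b ∷ q) = (a ℤ.+ b) ∷ (p +ₚ q)

-ₚ_ : Poly → Poly
-ₚ p = map ℤ.-_ p

_-ₚ_ : Poly → Poly → Poly
p -ₚ q = p +ₚ (-ₚ q)

-- (a + X·p)·q = a·q + X·(p·q)
_*ₚ_ : Poly → Poly → Poly
[]      *ₚ q = []
(a ∷ p) *ₚ q = map (a ℤ.*_) q +ₚ (0ℤ ∷ (p *ₚ q))

_^ₚ_ : Poly → ℕ → Poly
p ^ₚ zero  = const 1ℤ
p ^ₚ suc n = p *ₚ p ^ₚ n

-- The sum over all i with a ≤ i ≤ b; empty, hence zero, when b < a.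
sumₚ : ℕ → ℕ → (ℕ → Poly) → Poly
sumₚ a b f = foldr _+ₚ_ [] (applyUpTo (λ j → f (a ℕ.+ j)) (suc b ∸ a))

syntax sumₚ a b (λ i → p) = ∑[ i ∈ a ⋯ b ] p

{-# OPTIONS --safe #-}

-- Let a ℓ be the sequence of coefficients of X^ℓ in K 0, K 1, …, and put
-- m = k ∸ 2 and h i = (-1)^i C(m-1+i, m-1), the coefficients of (1+x)^(-m).
-- The recurrence says that the Cauchy product of h with a ℓ is 1 for ℓ = 0 and
-- -x·(a (ℓ-1)) for ℓ ≥ 1.  Multiplying m times by 1+x cancels h, so a 0 is
-- (1+x)^m and a ℓ = -x(1+x)^m·(a (ℓ-1)), whence a ℓ = (-x)^ℓ (1+x)^(m(ℓ+1)).
module Submission where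

open import Defs
open import Data.Nat.Base using (ℕ; zero; suc; _+_; _*_; _∸_; _≤_; s≤s; z≤n)
open import Data.Nat.Combinatorics using (_C_; nCn≡1; nCk+nC[k+1]≡[n+1]C[k+1])
open import Data.Integer.Base as ℤ using (ℤ; +_; 0ℤ; 1ℤ; -1ℤ)
import Data.Nat.Properties as ℕₚ
import Data.Integer.Properties as ℤₚ
open import Data.Integer.Tactic.RingSolver using (solve-∀)
open import Data.List.Base using ([]; _∷_; map; foldr; applyUpTo)
open import Function.Base using (_∘_)
open import Relation.Binary.PropositionalEquality

open ≡-Reasoning

-- Formal power series as integer sequences.

Seq : Set
Seq = ℕ → ℤ

∑< : ℕ → Seq → ℤ
∑< zero    f = 0ℤ
∑< (suc n) f = f 0 ℤ.+ ∑< n (f ∘ suc)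

conv : Seq → Seq → Seq
conv f g n = ∑< (suc n) (λ i → f i ℤ.* g (n ∸ i))

shift : Seq → Seq
shift f zero    = 0ℤ
shift f (suc n) = f n

scale : ℤ → Seq → Seq
scale c f n = c ℤ.* f n

-- Sequences are read as the power series they generate.
[1+x]· : Seq → Seq
[1+x]· f n = f n ℤ.+ shift f n

[1+x]^_· : ℕ → Seq → Seq
[1+x]^ zero  · f = f
[1+x]^ suc m · f = [1+x]^ m · ([1+x]· f)

-- The series x^i. Recursion on both arguments makes `δ (suc i) ∘ suc` reduce to `δ i`.
δ : ℕ → Seq
δ zero    zero    = 1ℤ
δ zero    (suc j) = 0ℤ
δ (suc i) zero    = 0ℤ
δ (suc i) (suc j) = δ i j

-- Finite sums, Cauchy products and multiplication by x^ℓ.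

∑<-cong : ∀ n {f g} → f ≗ g → ∑< n f ≡ ∑< n g
∑<-cong zero    eq = refl
∑<-cong (suc n) eq = cong₂ ℤ._+_ (eq 0) (∑<-cong n (eq ∘ suc))

∑<-zero : ∀ n {f} → (∀ i → f i ≡ 0ℤ) → ∑< n f ≡ 0ℤ
∑<-zero zero    eq = refl
∑<-zero (suc n) eq = cong₂ ℤ._+_ (eq 0) (∑<-zero n (eq ∘ suc))

∑<-+ : ∀ n f g → ∑< n (λ i → f i ℤ.+ g i) ≡ ∑< n f ℤ.+ ∑< n g
∑<-+ zero    f g = refl
∑<-+ (suc n) f g = trans
  (cong (λ s → (f 0 ℤ.+ g 0) ℤ.+ s) (∑<-+ n (f ∘ suc) (g ∘ suc)))
  (interchange (f 0) (g 0) _ _)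
  where
  interchange : ∀ a b c d → (a ℤ.+ b) ℤ.+ (c ℤ.+ d) ≡ (a ℤ.+ c) ℤ.+ (b ℤ.+ d)
  interchange = solve-∀

conv-congˡ : ∀ {f f′} g → f ≗ f′ → conv f g ≗ conv f′ g
conv-congˡ g eq n = ∑<-cong (suc n) (λ i → cong (ℤ._* g (n ∸ i)) (eq i))

conv-congʳ : ∀ f {g g′} → g ≗ g′ → conv f g ≗ conv f g′
conv-congʳ f eq n = ∑<-cong (suc n) (λ i → cong (f i ℤ.*_) (eq (n ∸ i)))

conv-+ˡ : ∀ f f′ g n → conv (λ i → f i ℤ.+ f′ i) g n ≡ conv f g n ℤ.+ conv f′ g n
conv-+ˡ f f′ g n = trans
  (∑<-cong (suc n) (λ i → ℤₚ.*-distribʳ-+ (g (n ∸ i)) (f i) (f′ i)))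
  (∑<-+ (suc n) (λ i → f i ℤ.* g (n ∸ i)) (λ i → f′ i ℤ.* g (n ∸ i)))

conv-δ-zero : ∀ g → conv (δ 0) g ≗ g
conv-δ-zero g n = begin
  1ℤ ℤ.* g n ℤ.+ ∑< n (λ i → 0ℤ ℤ.* g (n ∸ suc i)) ≡⟨ cong₂ ℤ._+_ (ℤₚ.*-identityˡ (g n)) (∑<-zero n (λ i → ℤₚ.*-zeroˡ (g (n ∸ suc i)))) ⟩
  g n ℤ.+ 0ℤ                                       ≡⟨ ℤₚ.+-identityʳ (g n) ⟩
  g n                                              ∎

-- The leading summand vanishes, and the remaining ones are definitionally the product with `δ ℓ`
-- one index lower.
conv-δ-suc : ∀ ℓ g → conv (δ (suc ℓ)) g ≗ shift (conv (δ ℓ) g)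
conv-δ-suc ℓ g zero    = trans (ℤₚ.+-identityʳ _) (ℤₚ.*-zeroˡ (g 0))
conv-δ-suc ℓ g (suc n) = trans
  (cong (ℤ._+ conv (δ ℓ) g n) (ℤₚ.*-zeroˡ (g (suc n))))
  (ℤₚ.+-identityˡ _)

shift-cong : ∀ {f g} → f ≗ g → shift f ≗ shift g
shift-cong eq zero    = refl
shift-cong eq (suc n) = eq n

shift-scale : ∀ c f → shift (scale c f) ≗ scale c (shift f)
shift-scale c f zero    = sym (ℤₚ.*-zeroʳ c)
shift-scale c f (suc n) = refl

scale-conv-δ : ∀ c ℓ g → scale c (conv (δ ℓ) g) ≗ conv (δ ℓ) (scale c g)
scale-conv-δ c zero    g n = trans
  (cong (c ℤ.*_) (conv-δ-zero g n))
  (sym (conv-δ-zero (scale c g) n))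
scale-conv-δ c (suc ℓ) g n = begin
  c ℤ.* conv (δ (suc ℓ)) g n         ≡⟨ cong (c ℤ.*_) (conv-δ-suc ℓ g n) ⟩
  c ℤ.* shift (conv (δ ℓ) g) n       ≡⟨ shift-scale c (conv (δ ℓ) g) n ⟨
  shift (scale c (conv (δ ℓ) g)) n   ≡⟨ shift-cong (scale-conv-δ c ℓ g) n ⟩
  shift (conv (δ ℓ) (scale c g)) n   ≡⟨ conv-δ-suc ℓ (scale c g) n ⟨
  conv (δ (suc ℓ)) (scale c g) n     ∎

-- Multiplication by powers of 1+x.

[1+x]-cong : ∀ {f g} → f ≗ g → [1+x]· f ≗ [1+x]· g
[1+x]-cong eq n = cong₂ ℤ._+_ (eq n) (shift-cong eq n)

[1+x]-shift : ∀ f → [1+x]· (shift f) ≗ shift ([1+x]· f)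
[1+x]-shift f zero    = refl
[1+x]-shift f (suc n) = refl

[1+x]-scale : ∀ c f → [1+x]· (scale c f) ≗ scale c ([1+x]· f)
[1+x]-scale c f n = trans
  (cong (ℤ._+_ (c ℤ.* f n)) (shift-scale c f n))
  (sym (ℤₚ.*-distribˡ-+ c (f n) (shift f n)))

-- Splitting off the first summand leaves the products of `f ∘ suc` and of `f` with `g`. By
-- additivity they combine into one, since `[1+x]· f` at `suc i` is `f (suc i) + f i`.
[1+x]-conv : ∀ f g → [1+x]· (conv f g) ≗ conv ([1+x]· f) g
[1+x]-conv f g zero    = trans (ℤₚ.+-identityʳ _)
  (cong (λ s → s ℤ.* g 0 ℤ.+ 0ℤ) (sym (ℤₚ.+-identityʳ (f 0))))
[1+x]-conv f g (suc n) = begin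
  (f 0 ℤ.* g (suc n) ℤ.+ conv (f ∘ suc) g n) ℤ.+ conv f g n
    ≡⟨ ℤₚ.+-assoc (f 0 ℤ.* g (suc n)) (conv (f ∘ suc) g n) (conv f g n) ⟩
  f 0 ℤ.* g (suc n) ℤ.+ (conv (f ∘ suc) g n ℤ.+ conv f g n)
    ≡⟨ cong₂ (λ s t → s ℤ.* g (suc n) ℤ.+ t) (sym (ℤₚ.+-identityʳ (f 0))) (sym (conv-+ˡ (f ∘ suc) f g n)) ⟩
  conv ([1+x]· f) g (suc n) ∎

[1+x]^-cong : ∀ m {f g} → f ≗ g → [1+x]^ m · f ≗ [1+x]^ m · g
[1+x]^-cong zero    eq = eq
[1+x]^-cong (suc m) eq = [1+x]^-cong m ([1+x]-cong eq)

[1+x]^-shift : ∀ m f → [1+x]^ m · (shift f) ≗ shift ([1+x]^ m · f)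
[1+x]^-shift zero    f n = refl
[1+x]^-shift (suc m) f n = trans
  ([1+x]^-cong m ([1+x]-shift f) n)
  ([1+x]^-shift m ([1+x]· f) n)

[1+x]^-scale : ∀ m c f → [1+x]^ m · (scale c f) ≗ scale c ([1+x]^ m · f)
[1+x]^-scale zero    c f n = refl
[1+x]^-scale (suc m) c f n = trans
  ([1+x]^-cong m ([1+x]-scale c f) n)
  ([1+x]^-scale m c ([1+x]· f) n)

[1+x]^-conv-δ : ∀ m ℓ g → [1+x]^ m · (conv (δ ℓ) g) ≗ conv (δ ℓ) ([1+x]^ m · g)
[1+x]^-conv-δ m zero    g n = trans
  ([1+x]^-cong m (conv-δ-zero g) n)
  (sym (conv-δ-zero ([1+x]^ m · g) n))
[1+x]^-conv-δ m (suc ℓ) g n = begin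
  ([1+x]^ m · (conv (δ (suc ℓ)) g)) n     ≡⟨ [1+x]^-cong m (conv-δ-suc ℓ g) n ⟩
  ([1+x]^ m · (shift (conv (δ ℓ) g))) n   ≡⟨ [1+x]^-shift m (conv (δ ℓ) g) n ⟩
  shift ([1+x]^ m · (conv (δ ℓ) g)) n     ≡⟨ shift-cong ([1+x]^-conv-δ m ℓ g) n ⟩
  shift (conv (δ ℓ) ([1+x]^ m · g)) n     ≡⟨ conv-δ-suc ℓ ([1+x]^ m · g) n ⟨
  conv (δ (suc ℓ)) ([1+x]^ m · g) n       ∎

-- Binomial series with positive and negative exponents.

binom : ℕ → Seq
binom N i = + (N C i)

-- Pascal's rule.
[1+x]-binom : ∀ N → [1+x]· (binom N) ≗ binom (suc N)
[1+x]-binom N zero    = refl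
[1+x]-binom N (suc i) = cong +_ (trans
  (ℕₚ.+-comm (N C suc i) (N C i))
  (nCk+nC[k+1]≡[n+1]C[k+1] N i))

[1+x]^-binom : ∀ m N → [1+x]^ m · (binom N) ≗ binom (m + N)
[1+x]^-binom zero    N i = refl
[1+x]^-binom (suc m) N i = begin
  ([1+x]^ m · ([1+x]· (binom N))) i   ≡⟨ [1+x]^-cong m ([1+x]-binom N) i ⟩
  ([1+x]^ m · (binom (suc N))) i      ≡⟨ [1+x]^-binom m (suc N) i ⟩
  binom (m + suc N) i                 ≡⟨ cong (λ M → binom M i) (ℕₚ.+-suc m N) ⟩
  binom (suc m + N) i                 ∎

binom-zero : binom 0 ≗ δ 0
binom-zero zero    = refl
binom-zero (suc i) = refl

-- The coefficients of (1 + x)^(-(p + 1)).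
negBinom : ℕ → Seq
negBinom p i = -1ℤ ℤ.^ i ℤ.* + ((p + i) C p)

negBinom-at-0 : ∀ p → negBinom p 0 ≡ 1ℤ
negBinom-at-0 p = trans (ℤₚ.*-identityˡ _)
  (cong +_ (trans (cong (_C p) (ℕₚ.+-identityʳ p)) (nCn≡1 p)))

-- The alternating geometric series: neighbouring terms cancel.
[1+x]-negBinom-zero : [1+x]· (negBinom 0) ≗ δ 0
[1+x]-negBinom-zero zero    = refl
[1+x]-negBinom-zero (suc i) = cancel (-1ℤ ℤ.^ i)
  where
  cancel : ∀ s → -1ℤ ℤ.* s ℤ.* 1ℤ ℤ.+ s ℤ.* 1ℤ ≡ 0ℤ
  cancel = solve-∀

-- Pascal's rule splits the coefficient in two; one part cancels against the shifted term, which has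
-- the opposite sign.
[1+x]-negBinom-suc : ∀ p → [1+x]· (negBinom (suc p)) ≗ negBinom p
[1+x]-negBinom-suc p zero    = trans (ℤₚ.+-identityʳ _)
  (trans (negBinom-at-0 (suc p)) (sym (negBinom-at-0 p)))
[1+x]-negBinom-suc p (suc i) = begin
  -1ℤ ℤ.* s ℤ.* + ((suc p + suc i) C suc p) ℤ.+ s ℤ.* + ((suc p + i) C suc p)
    ≡⟨ cong₂ (λ u v → -1ℤ ℤ.* s ℤ.* u ℤ.+ s ℤ.* + (v C suc p))
         (cong +_ (sym (nCk+nC[k+1]≡[n+1]C[k+1] (p + suc i) p)))
         (sym (ℕₚ.+-suc p i)) ⟩
  -1ℤ ℤ.* s ℤ.* (b ℤ.+ c) ℤ.+ s ℤ.* c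
    ≡⟨ cancel s b c ⟩
  -1ℤ ℤ.* s ℤ.* b ∎
  where
  s b c : ℤ
  s = -1ℤ ℤ.^ i
  b = + ((p + suc i) C p)
  c = + ((p + suc i) C suc p)
  cancel : ∀ s b c → -1ℤ ℤ.* s ℤ.* (b ℤ.+ c) ℤ.+ s ℤ.* c ≡ -1ℤ ℤ.* s ℤ.* b
  cancel = solve-∀

-- Each factor 1+x raises the negative exponent by one, until the last turns `negBinom 0` into the
-- unit `δ 0`.
[1+x]^-cancels-negBinom : ∀ p g → [1+x]^ suc p · (conv (negBinom p) g) ≗ g
[1+x]^-cancels-negBinom zero    g n = begin
  ([1+x]· (conv (negBinom 0) g)) n   ≡⟨ [1+x]-conv (negBinom 0) g n ⟩
  conv ([1+x]· (negBinom 0)) g n     ≡⟨ conv-congˡ g [1+x]-negBinom-zero n ⟩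
  conv (δ 0) g n                     ≡⟨ conv-δ-zero g n ⟩
  g n                                ∎
[1+x]^-cancels-negBinom (suc p) g n = trans
  ([1+x]^-cong (suc p) (λ i → trans
    ([1+x]-conv (negBinom (suc p)) g i)
    (conv-congˡ g ([1+x]-negBinom-suc p) i)) n)
  ([1+x]^-cancels-negBinom p g n)

-- Solving the recurrence for the coefficient sequences.

module _ (p : ℕ) (a : ℕ → Seq)
  (a-zero : conv (negBinom p) (a 0) ≗ δ 0)
  (a-suc  : ∀ ℓ → conv (negBinom p) (a (suc ℓ)) ≗ scale -1ℤ (shift (a ℓ)))
  where

  private
    m : ℕ
    m = suc p

    -- The expected `a ℓ` with its factor x^ℓ removed; `conv (δ ℓ)` restores that factor.
    b : ℕ → Seq
    b ℓ = scale (-1ℤ ℤ.^ ℓ) (binom (m * (ℓ + 1)))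

    b-suc : ∀ ℓ → [1+x]^ m · (scale -1ℤ (b ℓ)) ≗ b (suc ℓ)
    b-suc ℓ i = begin
      ([1+x]^ m · (scale -1ℤ (b ℓ))) i
        ≡⟨ [1+x]^-scale m -1ℤ (b ℓ) i ⟩
      -1ℤ ℤ.* ([1+x]^ m · (b ℓ)) i
        ≡⟨ cong (-1ℤ ℤ.*_) ([1+x]^-scale m (-1ℤ ℤ.^ ℓ) (binom (m * (ℓ + 1))) i) ⟩
      -1ℤ ℤ.* (-1ℤ ℤ.^ ℓ ℤ.* ([1+x]^ m · (binom (m * (ℓ + 1)))) i)
        ≡⟨ ℤₚ.*-assoc -1ℤ (-1ℤ ℤ.^ ℓ) _ ⟨
      -1ℤ ℤ.^ suc ℓ ℤ.* ([1+x]^ m · (binom (m * (ℓ + 1)))) i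
        ≡⟨ cong (-1ℤ ℤ.^ suc ℓ ℤ.*_) ([1+x]^-binom m (m * (ℓ + 1)) i) ⟩
      -1ℤ ℤ.^ suc ℓ ℤ.* binom (m + m * (ℓ + 1)) i
        ≡⟨ cong (λ N → -1ℤ ℤ.^ suc ℓ ℤ.* binom N i) (ℕₚ.*-suc m (ℓ + 1)) ⟨
      b (suc ℓ) i ∎

  solution : ∀ ℓ → a ℓ ≗ conv (δ ℓ) (scale (-1ℤ ℤ.^ ℓ) (binom (suc p * (ℓ + 1))))
  solution zero n = begin
    a 0 n                                            ≡⟨ [1+x]^-cancels-negBinom p (a 0) n ⟨
    -- The unit series is rewritten as (1+x)^0, to which the factors 1+x can be added.
    ([1+x]^ m · (conv (negBinom p) (a 0))) n         ≡⟨ [1+x]^-cong m (λ i → trans (a-zero i) (sym (binom-zero i))) n ⟩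
    ([1+x]^ m · (binom 0)) n                         ≡⟨ [1+x]^-binom m 0 n ⟩
    binom (m + 0) n                                  ≡⟨ cong (λ N → binom N n) (trans (ℕₚ.+-identityʳ m) (sym (ℕₚ.*-identityʳ m))) ⟩
    binom (m * 1) n                                  ≡⟨ ℤₚ.*-identityˡ _ ⟨
    b 0 n                                            ≡⟨ conv-δ-zero (b 0) n ⟨
    conv (δ 0) (b 0) n                               ∎
  solution (suc ℓ) n = begin
    a (suc ℓ) n                                              ≡⟨ [1+x]^-cancels-negBinom p (a (suc ℓ)) n ⟨
    ([1+x]^ m · (conv (negBinom p) (a (suc ℓ)))) n           ≡⟨ [1+x]^-cong m (λ i → trans (a-suc ℓ i) (sym (shift-scale -1ℤ (a ℓ) i))) n ⟩
    ([1+x]^ m · (shift (scale -1ℤ (a ℓ)))) n                 ≡⟨ [1+x]^-shift m (scale -1ℤ (a ℓ)) n ⟩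
    -- Induction hypothesis, with the sign moved past x^ℓ. The power of 1+x follows it inside, and
    -- the outer shift finally turns x^ℓ into x^(ℓ+1).
    shift ([1+x]^ m · (scale -1ℤ (a ℓ))) n                   ≡⟨ shift-cong ([1+x]^-cong m (λ i → trans (cong (-1ℤ ℤ.*_) (solution ℓ i)) (scale-conv-δ -1ℤ ℓ (b ℓ) i))) n ⟩
    shift ([1+x]^ m · (conv (δ ℓ) (scale -1ℤ (b ℓ)))) n      ≡⟨ shift-cong ([1+x]^-conv-δ m ℓ (scale -1ℤ (b ℓ))) n ⟩
    shift (conv (δ ℓ) ([1+x]^ m · (scale -1ℤ (b ℓ)))) n      ≡⟨ shift-cong (conv-congʳ (δ ℓ) (b-suc ℓ)) n ⟩
    shift (conv (δ ℓ) (b (suc ℓ))) n                         ≡⟨ conv-δ-suc ℓ (b (suc ℓ)) n ⟨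
    conv (δ (suc ℓ)) (b (suc ℓ)) n                           ∎

-- Coefficients of polynomial expressions.

coeff-+ : ∀ p q n → coeff (p +ₚ q) n ≡ coeff p n ℤ.+ coeff q n
coeff-+ []      q       n       = sym (ℤₚ.+-identityˡ _)
coeff-+ (a ∷ p) []      n       = sym (ℤₚ.+-identityʳ _)
coeff-+ (a ∷ p) (b ∷ q) zero    = refl
coeff-+ (a ∷ p) (b ∷ q) (suc n) = coeff-+ p q n

coeff-neg : ∀ p n → coeff (-ₚ p) n ≡ ℤ.- coeff p n
coeff-neg []      n       = refl
coeff-neg (a ∷ p) zero    = refl
coeff-neg (a ∷ p) (suc n) = coeff-neg p n

coeff-map-* : ∀ c p n → coeff (map (c ℤ.*_) p) n ≡ c ℤ.* coeff p n
coeff-map-* c []      n       = sym (ℤₚ.*-zeroʳ c)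
coeff-map-* c (a ∷ p) zero    = refl
coeff-map-* c (a ∷ p) (suc n) = coeff-map-* c p n

coeff-∷-* : ∀ c p q n → coeff ((c ∷ p) *ₚ q) n ≡ c ℤ.* coeff q n ℤ.+ shift (coeff (p *ₚ q)) n
coeff-∷-* c p q n = trans (coeff-+ (map (c ℤ.*_) q) (0ℤ ∷ (p *ₚ q)) n)
  (cong₂ ℤ._+_ (coeff-map-* c q n) (coeff-0∷ n))
  where
  coeff-0∷ : coeff (0ℤ ∷ (p *ₚ q)) ≗ shift (coeff (p *ₚ q))
  coeff-0∷ zero    = refl
  coeff-0∷ (suc n) = refl

coeff-const-* : ∀ c q n → coeff (const c *ₚ q) n ≡ c ℤ.* coeff q n
coeff-const-* c q n = trans (coeff-∷-* c [] q n)
  (trans (cong (ℤ._+_ (c ℤ.* coeff q n)) (shift-zero n)) (ℤₚ.+-identityʳ _))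
  where
  shift-zero : ∀ n → shift (coeff []) n ≡ 0ℤ
  shift-zero zero    = refl
  shift-zero (suc n) = refl

coeff-linear-* : ∀ c d q n →
  coeff ((c ∷ d ∷ []) *ₚ q) n ≡ c ℤ.* coeff q n ℤ.+ d ℤ.* shift (coeff q) n
coeff-linear-* c d q n = trans (coeff-∷-* c (const d) q n)
  (cong (ℤ._+_ (c ℤ.* coeff q n))
    (trans (shift-cong (coeff-const-* d q) n) (shift-scale d (coeff q) n)))

coeff-X^ : ∀ j → coeff (X ^ₚ j) ≗ δ j
coeff-X^ zero    zero    = refl
coeff-X^ zero    (suc n) = refl
coeff-X^ (suc j) n       = begin
  coeff (X *ₚ X ^ₚ j) n                                           ≡⟨ coeff-linear-* 0ℤ 1ℤ (X ^ₚ j) n ⟩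
  0ℤ ℤ.* coeff (X ^ₚ j) n ℤ.+ 1ℤ ℤ.* shift (coeff (X ^ₚ j)) n     ≡⟨ cong₂ ℤ._+_ (ℤₚ.*-zeroˡ (coeff (X ^ₚ j) n)) (ℤₚ.*-identityˡ (shift (coeff (X ^ₚ j)) n)) ⟩
  0ℤ ℤ.+ shift (coeff (X ^ₚ j)) n                                 ≡⟨ ℤₚ.+-identityˡ _ ⟩
  shift (coeff (X ^ₚ j)) n                                        ≡⟨ shift-cong (coeff-X^ j) n ⟩
  shift (δ j) n                                                   ≡⟨ shift-δ n ⟩
  δ (suc j) n                                                     ∎
  where
  shift-δ : shift (δ j) ≗ δ (suc j)
  shift-δ zero    = refl
  shift-δ (suc n) = refl

coeff-∑ : ∀ f N n → coeff (foldr _+ₚ_ [] (applyUpTo f N)) n ≡ ∑< N (λ j → coeff (f j) n)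
coeff-∑ f zero    n = refl
coeff-∑ f (suc N) n = trans (coeff-+ (f 0) _ n)
  (cong (ℤ._+_ (coeff (f 0) n)) (coeff-∑ (f ∘ suc) N n))

-- Both sides vanish unless `j` and `ℓ` agree. This turns the X^ℓ coefficient of a sum of monomials
-- into a Cauchy product with `δ ℓ`.
δ-sift : ∀ (φ : Seq) j ℓ → φ j ℤ.* δ j ℓ ≡ δ ℓ j ℤ.* φ ℓ
δ-sift φ zero    zero    = ℤₚ.*-comm (φ 0) 1ℤ
δ-sift φ zero    (suc ℓ) = trans (ℤₚ.*-zeroʳ (φ 0)) (sym (ℤₚ.*-zeroˡ (φ (suc ℓ))))
δ-sift φ (suc j) zero    = trans (ℤₚ.*-zeroʳ (φ (suc j))) (sym (ℤₚ.*-zeroˡ (φ 0)))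
δ-sift φ (suc j) (suc ℓ) = δ-sift (φ ∘ suc) j ℓ

-- From the polynomial recurrence to the coefficient sequences.

theorem7 : (k : ℕ) → 3 ≤ k →
    (K : ℕ → Poly) →
    K 0 ≈ₚ const 1ℤ →
    (∀ r → 1 ≤ r →
    K r ≈ₚ (const (+ ((k ∸ 2) C (k ∸ 3))) -ₚ X) *ₚ K (r ∸ 1)
    -ₚ (∑[ i ∈ 2 ⋯ r ] (const (-1ℤ ℤ.^ i ℤ.* + ((k + i ∸ 3) C (k ∸ 3))) *ₚ K (r ∸ i)))) →
    ∀ r →
    K r ≈ₚ (∑[ ℓ ∈ 0 ⋯ r ] (const (-1ℤ ℤ.^ ℓ ℤ.* + (((k ∸ 2) * (ℓ + 1)) C (r ∸ ℓ))) *ₚ X ^ₚ ℓ))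
-- With k = p + 3 the truncated subtractions compute: `k ∸ 2` is `suc p`, `k ∸ 3` is `p`, and the
-- summation coefficients become `negBinom p i`.
theorem7 (suc (suc (suc p))) (s≤s (s≤s (s≤s z≤n))) K K₀ rec r ℓ = begin
  coeff (K r) ℓ                                          ≡⟨ solution p a a-zero a-suc ℓ r ⟩
  conv (δ ℓ) (λ i → φ i ℓ) r                             ≡⟨ ∑<-cong (suc r) term ⟨
  ∑< (suc r) (λ j → coeff (const (φ (r ∸ j) j) *ₚ X ^ₚ j) ℓ)
    ≡⟨ coeff-∑ (λ j → const (φ (r ∸ j) j) *ₚ X ^ₚ j) (suc r) ℓ ⟨
  coeff (∑[ j ∈ 0 ⋯ r ] (const (φ (r ∸ j) j) *ₚ X ^ₚ j)) ℓ ∎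
  where
  a : ℕ → Seq
  a ℓ r = coeff (K r) ℓ

  -- The lower index of the binomial is kept apart from the power of X, so that `δ-sift` can replace
  -- `j` by `ℓ` while `r ∸ j` stays.
  φ : ℕ → Seq
  φ i j = -1ℤ ℤ.^ j ℤ.* + ((suc p * (j + 1)) C i)

  term : ∀ j → coeff (const (φ (r ∸ j) j) *ₚ X ^ₚ j) ℓ ≡ δ ℓ j ℤ.* φ (r ∸ j) ℓ
  term j = begin
    coeff (const (φ (r ∸ j) j) *ₚ X ^ₚ j) ℓ   ≡⟨ coeff-const-* (φ (r ∸ j) j) (X ^ₚ j) ℓ ⟩
    φ (r ∸ j) j ℤ.* coeff (X ^ₚ j) ℓ          ≡⟨ cong (φ (r ∸ j) j ℤ.*_) (coeff-X^ j ℓ) ⟩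
    φ (r ∸ j) j ℤ.* δ j ℓ                     ≡⟨ δ-sift (φ (r ∸ j)) j ℓ ⟩
    δ ℓ j ℤ.* φ (r ∸ j) ℓ                     ∎

  -- The terms i = 2 + j of the product at index `suc t`, where `suc t ∸ i` is `t ∸ suc j`; there
  -- are `t` of them.
  tail : ℕ → ℕ → ℤ
  tail ℓ t = ∑< t (λ j → negBinom p (2 + j) ℤ.* a ℓ (t ∸ suc j))

  c : ℤ
  c = + (suc p C p)

  coeff-rec : ∀ ℓ t →
    a ℓ (suc t) ≡ c ℤ.* a ℓ t ℤ.+ -1ℤ ℤ.* shift (coeff (K t)) ℓ ℤ.+ ℤ.- tail ℓ t
  coeff-rec ℓ t = begin
    a ℓ (suc t)                     ≡⟨ rec (suc t) (s≤s z≤n) ℓ ⟩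
    coeff (P -ₚ Q) ℓ                ≡⟨ coeff-+ P (-ₚ Q) ℓ ⟩
    coeff P ℓ ℤ.+ coeff (-ₚ Q) ℓ
      -- `const c -ₚ X` computes to the list `(c + 0ℤ) ∷ -1ℤ ∷ []`, hence the extra zero.
      ≡⟨ cong₂ ℤ._+_ (coeff-linear-* (c ℤ.+ 0ℤ) -1ℤ (K t) ℓ)
           (trans (coeff-neg Q ℓ) (cong ℤ.-_ (trans (coeff-∑ (λ j → const (negBinom p (2 + j)) *ₚ K (t ∸ suc j)) t ℓ)
             (∑<-cong t (λ j → coeff-const-* (negBinom p (2 + j)) (K (t ∸ suc j)) ℓ))))) ⟩
    (c ℤ.+ 0ℤ) ℤ.* a ℓ t ℤ.+ -1ℤ ℤ.* shift (coeff (K t)) ℓ ℤ.+ ℤ.- tail ℓ t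
      ≡⟨ cong (λ d → d ℤ.* a ℓ t ℤ.+ -1ℤ ℤ.* shift (coeff (K t)) ℓ ℤ.+ ℤ.- tail ℓ t) (ℤₚ.+-identityʳ c) ⟩
    c ℤ.* a ℓ t ℤ.+ -1ℤ ℤ.* shift (coeff (K t)) ℓ ℤ.+ ℤ.- tail ℓ t ∎
    where
    P Q : Poly
    P = (const c -ₚ X) *ₚ K t
    Q = ∑[ i ∈ 2 ⋯ suc t ] (const (negBinom p i) *ₚ K (suc t ∸ i))

  conv-at-0 : ∀ ℓ → conv (negBinom p) (a ℓ) 0 ≡ δ 0 ℓ
  conv-at-0 ℓ = begin
    negBinom p 0 ℤ.* a ℓ 0 ℤ.+ 0ℤ   ≡⟨ ℤₚ.+-identityʳ _ ⟩
    negBinom p 0 ℤ.* a ℓ 0          ≡⟨ cong₂ ℤ._*_ (negBinom-at-0 p) (trans (K₀ ℓ) (coeff-X^ 0 ℓ)) ⟩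
    1ℤ ℤ.* δ 0 ℓ                    ≡⟨ ℤₚ.*-identityˡ _ ⟩
    δ 0 ℓ                           ∎

  negBinom-at-1 : negBinom p 1 ≡ ℤ.- c
  negBinom-at-1 = trans (ℤₚ.-1*i≡-i _)
    (cong (λ N → ℤ.- + (N C p)) (ℕₚ.+-comm p 1))

  -- The recurrence with all terms but the one from multiplication by X brought to one side: they
  -- are the product's terms i = 0, i = 1 and i ≥ 2. The shift is in the degree of X.
  conv-at-suc : ∀ ℓ t → conv (negBinom p) (a ℓ) (suc t) ≡ -1ℤ ℤ.* shift (coeff (K t)) ℓ
  conv-at-suc ℓ t = begin
    negBinom p 0 ℤ.* a ℓ (suc t) ℤ.+ (negBinom p 1 ℤ.* a ℓ t ℤ.+ tail ℓ t)
      ≡⟨ cong₂ ℤ._+_ (cong₂ ℤ._*_ (negBinom-at-0 p) (coeff-rec ℓ t))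
           (cong (λ h → h ℤ.* a ℓ t ℤ.+ tail ℓ t) negBinom-at-1) ⟩
    1ℤ ℤ.* (c ℤ.* a ℓ t ℤ.+ -1ℤ ℤ.* s ℤ.+ ℤ.- tail ℓ t) ℤ.+ (ℤ.- c ℤ.* a ℓ t ℤ.+ tail ℓ t)
      ≡⟨ cancel c (a ℓ t) s (tail ℓ t) ⟩
    -1ℤ ℤ.* s ∎
    where
    s : ℤ
    s = shift (coeff (K t)) ℓ
    cancel : ∀ c x s y →
      1ℤ ℤ.* (c ℤ.* x ℤ.+ -1ℤ ℤ.* s ℤ.+ ℤ.- y) ℤ.+ (ℤ.- c ℤ.* x ℤ.+ y) ≡ -1ℤ ℤ.* s
    cancel = solve-∀

  a-zero : conv (negBinom p) (a 0) ≗ δ 0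
  a-zero zero    = conv-at-0 0
  a-zero (suc t) = conv-at-suc 0 t

  -- The shift in the degree of X at `suc ℓ` and the shift in the index at `suc t` both reduce to
  -- `a ℓ t`.
  a-suc : ∀ ℓ → conv (negBinom p) (a (suc ℓ)) ≗ scale -1ℤ (shift (a ℓ))
  a-suc ℓ zero    = conv-at-0 (suc ℓ)
  a-suc ℓ (suc t) = conv-at-suc (suc ℓ) t
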